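{- For integers $k \ge 1$ and $n \ge 1$, let $\mathcal{C}_{k,n}$ be the family of all graphs on a fixed vertex set $V$ of size $n$ having clique-width at most $k$. Then $\mathcal{C}_{k,n}$ has an adjacency labeling scheme of size $O(k \log k \log n)$; that is, there is an absolute constant $C > 0$ such that for all $k, n \ge 1$ there is an $L$-bit adjacency labeling scheme for $\mathcal{C}_{k,n}$ with $L \le C\, k \log_2 k \, \log_2 n$. Moreover, if $k$ is bounded, this is optimal up to a constant factor: for every $K \ge 1$ there is a constant $c_K > 0$ such that for all $1 \le k \le K$ and all $n \ge 1$, every $L$-bit adjacency labeling scheme for $\mathcal{C}_{k,n}$ satisfies $L \ge c_K\, k \log_2 k\, \log_2 n$.
   Context: All graphs are finite, undirected, without self-loops or parallel edges. For a graph $G=(V,E)$ and $u,v \in V$, put $\mathsf{adj}(u,v) = 1$ if $\{u,v\}\in E$ and $\mathsf{adj}(u,v)=0$ otherwise. Adjacency labeling scheme: let $\mathcal{F}_n$ be a family of graphs on the vertex set $V$, $|V| = n$. An $L$-bit adjacency labeling scheme of $\mathcal{F}_n$ is a pair of functions $\mathsf{enc}: \mathcal{F}_n \to (V \to \{0,1\}^L)$ and $\mathsf{dec}: \{0,1\}^L \times \{0,1\}^L \to \{0,1\}$ such that for all $G = (V,E)\in \mathcal{F}_n$ and all $u,v\in V$, $\mathsf{adj}(u,v) = \mathsf{dec}(\mathsf{enc}(G)(u), \mathsf{enc}(G)(v))$. (So $\mathsf{dec}$ may depend on the family, but not on the individual graph $G$.) Clique-width: the clique-width of a graph $G$ is the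 minimum number of vertex labels needed to construct $G$ using the following four operations on vertex-labeled graphs: (1) create a single vertex $v$ with label $i$; (2) disjoint union $G_1 \oplus G_2$ of two labeled graphs; (3) join $\eta_{i,j}$ with $i\neq j$, which adds an edge between every pair of vertices one of which has label $i$ and the other label $j$; (4) relabel $\rho_{i\to j}$, which changes the label of all vertices with label $i$ to label $j$. -}

module Defs where

open import Data.Bool using (Bool; false; if_then_else_; _∧_; _∨_)
open import Data.Fin using (Fin; _≟_)
open import Data.Integer using (+_; -[1+_])
open import Data.Nat using (ℕ; suc; _*_; _^_; _≤_)
open import Data.Product using (Σ; ∃; _×_)
open import Data.Rational.Unnormalised as ℚᵘ using (ℚᵘ; mkℚᵘ; 0ℚᵘ)
open import Data.Sum using (_⊎_; inj₁; inj₂)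
open import Data.Unit using (⊤)
open import Data.Vec using (Vec)
open import Function.Bundles using (_↔_; Inverse)
open import Relation.Binary.PropositionalEquality using (_≡_; _≢_)
open import Relation.Nullary using (does)

record Graph (V : Set) : Set where
  field
    adj         : V → V → Bool
    symmetric   : ∀ u v → adj u v ≡ adj v u
    irreflexive : ∀ v → adj v v ≡ false

open Graph public

-- Membership in the family is an irrelevant argument of enc, so that labels
-- depend on the graph only and not on the evidence that it is in the family.
record LabelingScheme {V : Set} (F : Graph V → Set) (L : ℕ) : Set where
  field
    enc     : (G : Graph V) → .(F G) → V → Vec Bool L
    dec     : Vec Bool L → Vec Bool L → Bool
    correct : ∀ G (G∈F : F G) u v →
              adj G u v ≡ dec (enc G G∈F u) (enc G G∈F v)

data Expr (k : ℕ) : Set where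
  vertex : Fin k → Expr k
  _⊕_    : Expr k → Expr k → Expr k
  η      : (i j : Fin k) → i ≢ j → Expr k → Expr k
  ρ      : (i j : Fin k) → Expr k → Expr k

Vertex : ∀ {k} → Expr k → Set
Vertex (vertex _)  = ⊤
Vertex (d ⊕ e)     = Vertex d ⊎ Vertex e
Vertex (η _ _ _ e) = Vertex e
Vertex (ρ _ _ e)   = Vertex e

label : ∀ {k} (e : Expr k) → Vertex e → Fin k
label (vertex i)  _        = i
label (d ⊕ e)     (inj₁ v) = label d v
label (d ⊕ e)     (inj₂ v) = label e v
label (η _ _ _ e) v        = label e v
label (ρ i j e)   v        =
  if does (label e v ≟ i) then j else label e v

hasLabel : ∀ {k} (e : Expr k) → Vertex e → Fin k → Bool
hasLabel e v i = does (label e v ≟ i)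

edge : ∀ {k} (e : Expr k) → Vertex e → Vertex e → Bool
edge (vertex _)  _        _        = false
edge (d ⊕ e)     (inj₁ u) (inj₁ v) = edge d u v
edge (d ⊕ e)     (inj₂ u) (inj₂ v) = edge e u v
edge (d ⊕ e)     (inj₁ _) (inj₂ _) = false
edge (d ⊕ e)     (inj₂ _) (inj₁ _) = false
edge (η i j _ e) u        v        =
  edge e u v ∨ (hasLabel e u i ∧ hasLabel e v j)
             ∨ (hasLabel e u j ∧ hasLabel e v i)
edge (ρ _ _ e)   u        v        = edge e u v

Constructs : ∀ {k} {V : Set} → Expr k → Graph V → Set
Constructs {V = V} e G =
  Σ (Vertex e ↔ V) λ f →
    ∀ u v → edge e u v ≡ adj G (Inverse.to f u) (Inverse.to f v)

Constructible : ∀ {V : Set} → ℕ → Graph V → Set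
Constructible k G = ∃ λ (e : Expr k) → Constructs e G

IsCliqueWidth : ∀ {V : Set} → Graph V → ℕ → Set
IsCliqueWidth G w =
  Constructible w G × (∀ w′ → Constructible w′ G → w ≤ w′)

𝒞 : (k n : ℕ) → Graph (Fin n) → Set
𝒞 k n G = ∃ λ w → IsCliqueWidth G w × w ≤ k

-- For m ≥ 1, comparison of the rational a / b with the real number log₂ m,
-- obtained by exponentiating: log₂ m ≤ a / b  iff  m ^ b ≤ 2 ^ a.
-- A negative numerator is moved to the other side.
_≥log₂_ : ℚᵘ → ℕ → Set
mkℚᵘ (+ a)    b-1 ≥log₂ m = m ^ suc b-1 ≤ 2 ^ a
mkℚᵘ -[1+ a ] b-1 ≥log₂ m = m ^ suc b-1 * 2 ^ suc a ≤ 1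

_≤log₂_ : ℚᵘ → ℕ → Set
mkℚᵘ (+ a)    b-1 ≤log₂ m = 2 ^ a ≤ m ^ suc b-1
mkℚᵘ -[1+ a ] b-1 ≤log₂ m = 1 ≤ m ^ suc b-1 * 2 ^ suc a

fromℕ : ℕ → ℚᵘ
fromℕ m = + m ℚᵘ./ 1

-- The real inequality L ≤ r · log₂ a · log₂ b, for r ≥ 0 and a , b ≥ 1:
-- the right-hand side is the infimum of r · p · q over rationals
-- p ≥ log₂ a and q ≥ log₂ b.
AtMostLogs : (r : ℚᵘ) (a b L : ℕ) → Set
AtMostLogs r a b L =
  ∀ p q → p ≥log₂ a → q ≥log₂ b →
  fromℕ L ℚᵘ.≤ r ℚᵘ.* p ℚᵘ.* q

-- The real inequality L ≥ r · log₂ a · log₂ b, for r ≥ 0 and a , b ≥ 1: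
-- the right-hand side is the supremum of r · p · q over rationals
-- 0 ≤ p ≤ log₂ a and 0 ≤ q ≤ log₂ b.
AtLeastLogs : (r : ℚᵘ) (a b L : ℕ) → Set
AtLeastLogs r a b L =
  ∀ p q → 0ℚᵘ ℚᵘ.≤ p → 0ℚᵘ ℚᵘ.≤ q → p ≤log₂ a → q ≤log₂ b →
  r ℚᵘ.* p ℚᵘ.* q ℚᵘ.≤ fromℕ L

{-# OPTIONS --safe #-}

-- Upper bound: walking down the expression towards the heavier operand, one
-- meets a subexpression holding between one and two thirds of the current
-- vertices.  An outside vertex is adjacent to an inside vertex u according to
-- the label of u in the subexpression only, so one level of the encoding costs
-- a side bit and k further bits: the one-hot label of an inside vertex, or the
-- set of labels seen by an outside vertex.  Recursing on both sides gives
-- O(log n) levels, hence O(k log n) bits, and log₂ k ≥ 1 once k ≥ 2.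
-- Lower bound: an encoding of the complete graph, which has clique-width 2, is
-- injective, because equal labels would be decoded as a loop; so n ≤ 2 ^ L.
module Submission where

open import Defs
open import Data.Nat using (ℕ; _≤_)
open import Data.Product using (∃; _×_)
open import Data.Rational.Unnormalised as ℚᵘ using (ℚᵘ; mkℚᵘ; 0ℚᵘ)

open import Data.Bool using (Bool; true; false; not; _∧_; _∨_; _xor_; if_then_else_)
open import Data.Bool.Properties using (∧-comm; ∧-identityʳ; ∧-zeroʳ; ∨-identityʳ)
import Data.Bool.Properties as Bool
open import Data.Empty using (⊥-elim)
open import Data.Fin using (Fin; zero; suc; _≟_; combine)
open import Data.Fin.Patterns using (0F; 1F)
open import Data.Fin.Permutation using (↔⇒≡)
open import Data.Fin.Properties using (+↔⊎; 1↔⊤; 2↔Bool; combine-injective; injective⇒≤)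
import Data.Fin.Properties as Fin
open import Data.Integer using (-[1+_])
import Data.Integer as ℤ
import Data.Integer.Properties as ℤ
open import Data.Nat using (zero; suc; _+_; _*_; _^_; _<_; _/_; >-nonZero; z≤n; s≤s)
open import Data.Nat.DivMod using (m*n/n≡m; m/n*n≤m; /-monoˡ-≤; m≥n⇒m/n>0; m<n*o⇒m/o<n)
open import Data.Nat.Properties hiding (_≟_)
open import Data.Nat.Solver using (module +-*-Solver)
open import Data.Product using (Σ; _,_; proj₁; proj₂)
open import Data.Sum using (inj₁; inj₂)
open import Data.Unit using (tt)
open import Data.Vec using (Vec; []; _∷_; _++_; take; drop; tabulate; lookup; padRight; replicate)
open import Data.Vec.Properties using (take++drop≡id; ++-injectiveˡ; ++-injectiveʳ; lookup∘tabulate)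
open import Data.Fin.Subset.Properties using (anySubset?)
open import Function using (_∘_; const)
open import Function.Definitions using (Injective)
open import Function.Bundles using (_↔_; Injection; Inverse)
open import Function.Properties.Inverse using (↔-sym; ↔-trans; ↔⇒↣)
open import Data.Sum.Function.Propositional using (_⊎-↔_)
open import Relation.Binary.PropositionalEquality
open import Relation.Nullary using (Dec; yes; no; does; contradiction; ¬_)
open import Relation.Nullary.Decidable using (recompute; map′; dec-true; dec-false)
open import Relation.Unary using (Decidable)

-- Vertex subsets of an expression and their cardinality.

_∩_ _∖_ : {A : Set} → (A → Bool) → (A → Bool) → A → Bool
(S ∩ T) v = S v ∧ T v
(S ∖ T) v = S v ∧ not (T v)

weight : ∀ {k} (e : Expr k) → (Vertex e → Bool) → ℕ
weight (vertex _)  S = if S tt then 1 else 0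
weight (d ⊕ e)     S = weight d (S ∘ inj₁) + weight e (S ∘ inj₂)
weight (η _ _ _ e) S = weight e S
weight (ρ _ _ e)   S = weight e S

weight-cong : ∀ {k} (e : Expr k) {S T} → (∀ v → S v ≡ T v) → weight e S ≡ weight e T
weight-cong (vertex _)  eq = cong (if_then 1 else 0) (eq tt)
weight-cong (d ⊕ e)     eq = cong₂ _+_ (weight-cong d (eq ∘ inj₁)) (weight-cong e (eq ∘ inj₂))
weight-cong (η _ _ _ e) eq = weight-cong e eq
weight-cong (ρ _ _ e)   eq = weight-cong e eq

weight-∅ : ∀ {k} (e : Expr k) → weight e (const false) ≡ 0
weight-∅ (vertex _)  = refl
weight-∅ (d ⊕ e)     = cong₂ _+_ (weight-∅ d) (weight-∅ e)
weight-∅ (η _ _ _ e) = weight-∅ e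
weight-∅ (ρ _ _ e)   = weight-∅ e

weight-∩-∖ : ∀ {k} (e : Expr k) S T → weight e (S ∩ T) + weight e (S ∖ T) ≡ weight e S
weight-∩-∖ (vertex _) S T with S tt | T tt
... | true  | true  = refl
... | true  | false = refl
... | false | _     = refl
weight-∩-∖ (d ⊕ e) S T = begin
  (a + b) + (c + f)  ≡⟨ +-*-Solver.solve 4 (λ a b c f → (a :+ b) :+ (c :+ f) := (a :+ c) :+ (b :+ f)) refl a b c f ⟩
  (a + c) + (b + f)  ≡⟨ cong₂ _+_ (weight-∩-∖ d (S ∘ inj₁) (T ∘ inj₁)) (weight-∩-∖ e (S ∘ inj₂) (T ∘ inj₂)) ⟩
  weight (d ⊕ e) S   ∎
  where
  open ≡-Reasoning
  open +-*-Solver using (_:+_; _:=_)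
  a = weight d ((S ∩ T) ∘ inj₁)
  b = weight e ((S ∩ T) ∘ inj₂)
  c = weight d ((S ∖ T) ∘ inj₁)
  f = weight e ((S ∖ T) ∘ inj₂)
weight-∩-∖ (η _ _ _ e) S T = weight-∩-∖ e S T
weight-∩-∖ (ρ _ _ e)   S T = weight-∩-∖ e S T

weight-∩-all : ∀ {k} (e : Expr k) S → weight e (S ∩ const true) ≡ weight e S
weight-∩-all e S = weight-cong e (λ v → ∧-identityʳ (S v))

weight-∩-none : ∀ {k} (e : Expr k) S → weight e (S ∩ const false) ≡ 0
weight-∩-none e S = trans (weight-cong e (λ v → ∧-zeroʳ (S v))) (weight-∅ e)

weight>0 : ∀ {k} (e : Expr k) {S} v → S v ≡ true → 1 ≤ weight e S
weight>0 (vertex _)  tt       Sv rewrite Sv = ≤-refl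
weight>0 (d ⊕ e)     (inj₁ v) Sv = ≤-trans (weight>0 d v Sv) (m≤m+n _ _)
weight>0 (d ⊕ e)     (inj₂ v) Sv = ≤-trans (weight>0 e v Sv) (m≤n+m _ _)
weight>0 (η _ _ _ e) v        Sv = weight>0 e v Sv
weight>0 (ρ _ _ e)   v        Sv = weight>0 e v Sv

-- Members of `S` on opposite sides of a union would each contribute 1 to the weight. This ends the
-- recursion of `encoding`: in such a set only the pair of a vertex with itself is left to decode.
weight≤1⇒≡ : ∀ {k} (e : Expr k) {S} → weight e S ≤ 1 →
             ∀ u v → S u ≡ true → S v ≡ true → u ≡ v
weight≤1⇒≡ (vertex _)  _  _        _        _  _  = refl
weight≤1⇒≡ (d ⊕ e)     w≤ (inj₁ u) (inj₁ v) Su Sv =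
  cong inj₁ (weight≤1⇒≡ d (m+n≤o⇒m≤o _ w≤) u v Su Sv)
weight≤1⇒≡ (d ⊕ e)     w≤ (inj₂ u) (inj₂ v) Su Sv =
  cong inj₂ (weight≤1⇒≡ e (m+n≤o⇒n≤o _ w≤) u v Su Sv)
weight≤1⇒≡ (d ⊕ e)     w≤ (inj₁ u) (inj₂ v) Su Sv =
  contradiction (≤-trans (+-mono-≤ (weight>0 d u Su) (weight>0 e v Sv)) w≤) 1+n≰n
weight≤1⇒≡ (d ⊕ e)     w≤ (inj₂ u) (inj₁ v) Su Sv =
  contradiction (≤-trans (+-mono-≤ (weight>0 d v Sv) (weight>0 e u Su)) w≤) 1+n≰n
weight≤1⇒≡ (η _ _ _ e) w≤ u        v        Su Sv = weight≤1⇒≡ e w≤ u v Su Sv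
weight≤1⇒≡ (ρ _ _ e)   w≤ u        v        Su Sv = weight≤1⇒≡ e w≤ u v Su Sv

-- Splits induced by subexpressions.

-- The vertices of a subexpression of e (side), their labels there (class), and
-- the effect of the remaining relabelings on those labels (relabel).  Values of
-- class outside side and of neighbour inside side are junk.
record Split {k} (e : Expr k) : Set where
  field
    side        : Vertex e → Bool
    class       : Vertex e → Fin k
    relabel     : Fin k → Fin k
    neighbour   : Vertex e → Fin k → Bool
    label-class : ∀ u → side u ≡ true → label e u ≡ relabel (class u)
    edge-class  : ∀ u v → side u ≡ true → side v ≡ false →
                  edge e u v ≡ neighbour v (class u)

open Split

wholeˡ : ∀ {k} (d e : Expr k) → Split (d ⊕ e)
wholeˡ d e = λ where
  .side (inj₁ _) → true
  .side (inj₂ _) → false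
  .class → label (d ⊕ e)
  .relabel i → i
  .neighbour _ _ → false
  .label-class _ _ → refl
  .edge-class (inj₁ _) (inj₂ _) _ _ → refl

wholeʳ : ∀ {k} (d e : Expr k) → Split (d ⊕ e)
wholeʳ d e = λ where
  .side (inj₁ _) → false
  .side (inj₂ _) → true
  .class → label (d ⊕ e)
  .relabel i → i
  .neighbour _ _ → false
  .label-class _ _ → refl
  .edge-class (inj₂ _) (inj₁ _) _ _ → refl

insideˡ : ∀ {k} {d : Expr k} (e : Expr k) → Split d → Split (d ⊕ e)
insideˡ e s = λ where
  .side (inj₁ v) → side s v
  .side (inj₂ _) → false
  .class (inj₁ v) → class s v
  .class (inj₂ v) → label e v
  .relabel → relabel s
  .neighbour (inj₁ v) → neighbour s v
  .neighbour (inj₂ _) _ → false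
  .label-class (inj₁ u) → label-class s u
  .edge-class (inj₁ u) (inj₁ v) → edge-class s u v
  .edge-class (inj₁ _) (inj₂ _) _ _ → refl

insideʳ : ∀ {k} (d : Expr k) {e : Expr k} → Split e → Split (d ⊕ e)
insideʳ d s = λ where
  .side (inj₁ _) → false
  .side (inj₂ v) → side s v
  .class (inj₁ v) → label d v
  .class (inj₂ v) → class s v
  .relabel → relabel s
  .neighbour (inj₁ _) _ → false
  .neighbour (inj₂ v) → neighbour s v
  .label-class (inj₂ u) → label-class s u
  .edge-class (inj₂ u) (inj₂ v) → edge-class s u v
  .edge-class (inj₂ _) (inj₁ _) _ _ → refl

-- The join inspects an inside vertex `u` only through its current label, which is
-- `relabel s (class s u)`. So the new edges from `v` still depend on the class of `u` alone and can
-- be merged into `neighbour`.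
inside-η : ∀ {k} {e : Expr k} i j i≢j → Split e → Split (η i j i≢j e)
inside-η {e = e} i j _ s = λ where
  .side → side s
  .class → class s
  .relabel → relabel s
  .neighbour v c → neighbour s v c ∨ (does (relabel s c ≟ i) ∧ hasLabel e v j)
                                   ∨ (does (relabel s c ≟ j) ∧ hasLabel e v i)
  .label-class → label-class s
  .edge-class u v u∈ v∉ → cong₂
    (λ b l → b ∨ (does (l ≟ i) ∧ hasLabel e v j) ∨ (does (l ≟ j) ∧ hasLabel e v i))
    (edge-class s u v u∈ v∉) (label-class s u u∈)

inside-ρ : ∀ {k} {e : Expr k} i j → Split e → Split (ρ i j e)
inside-ρ i j s = λ where
  .side → side s
  .class → class s
  .relabel c → if does (relabel s c ≟ i) then j else relabel s c
  .neighbour → neighbour s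
  .label-class u u∈ → cong (λ l → if does (l ≟ i) then j else l) (label-class s u u∈)
  .edge-class → edge-class s

-- Balanced splits.

Balanced : ∀ {k} (e : Expr k) → (Vertex e → Bool) → ℕ → Split e → Set
Balanced e S t s = weight e (S ∩ side s) ≤ t × t < 2 * weight e (S ∩ side s)

larger-half : ∀ {t} m n → t < m + n → n ≤ m → t < 2 * m
larger-half {t} m n t< n≤m = begin-strict
  t      <⟨ t< ⟩
  m + n  ≤⟨ +-monoʳ-≤ m n≤m ⟩
  m + m  ≡⟨ cong (m +_) (+-identityʳ m) ⟨
  2 * m  ∎
  where open ≤-Reasoning

-- Descend into an operand as long as one has weight above `t`. At the first union where neither
-- has, the larger operand carries at least half of a weight exceeding `t`. A single vertex is never
-- reached, its weight being at most 1.
balanced-split : ∀ {k} (e : Expr k) S t → 1 ≤ t → t < weight e S → ∃ (Balanced e S t)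
balanced-split (vertex _) S t 1≤t t< with S tt
... | true  = contradiction (≤-trans t< 1≤t) 1+n≰n
... | false = contradiction t< λ ()
balanced-split (d ⊕ e) S t 1≤t t<
  with weight d (S ∘ inj₁) ≤? t | weight e (S ∘ inj₂) ≤? t
... | no d≰t | _ with s , b ← balanced-split d (S ∘ inj₁) t 1≤t (≰⇒> d≰t) =
  insideˡ e s , subst (λ w → w ≤ t × t < 2 * w) (sym eq) b
  where
  eq : weight (d ⊕ e) (S ∩ side (insideˡ e s)) ≡ weight d ((S ∘ inj₁) ∩ side s)
  eq = trans (cong (weight d ((S ∘ inj₁) ∩ side s) +_) (weight-∩-none e (S ∘ inj₂))) (+-identityʳ _)
... | yes _ | no e≰t with s , b ← balanced-split e (S ∘ inj₂) t 1≤t (≰⇒> e≰t) =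
  insideʳ d s , subst (λ w → w ≤ t × t < 2 * w) (sym eq) b
  where
  eq : weight (d ⊕ e) (S ∩ side (insideʳ d s)) ≡ weight e ((S ∘ inj₂) ∩ side s)
  eq = cong (_+ weight e ((S ∘ inj₂) ∩ side s)) (weight-∩-none d (S ∘ inj₁))
... | yes d≤t | yes e≤t with ≤-total (weight e (S ∘ inj₂)) (weight d (S ∘ inj₁))
... | inj₁ e≤d = wholeˡ d e , subst (λ w → w ≤ t × t < 2 * w) (sym eq)
                   (d≤t , larger-half _ _ t< e≤d)
  where
  eq : weight (d ⊕ e) (S ∩ side (wholeˡ d e)) ≡ weight d (S ∘ inj₁)
  eq = trans (cong₂ _+_ (weight-∩-all d (S ∘ inj₁)) (weight-∩-none e (S ∘ inj₂))) (+-identityʳ _)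
... | inj₂ d≤e = wholeʳ d e , subst (λ w → w ≤ t × t < 2 * w) (sym eq)
                   (e≤t , larger-half _ _ (subst (t <_) (+-comm (weight d _) _) t<) d≤e)
  where
  eq : weight (d ⊕ e) (S ∩ side (wholeʳ d e)) ≡ weight e (S ∘ inj₂)
  eq = cong₂ _+_ (weight-∩-none d (S ∘ inj₁)) (weight-∩-all e (S ∘ inj₂))
balanced-split (η i j i≢j e) S t 1≤t t< with s , b ← balanced-split e S t 1≤t t< =
  inside-η i j i≢j s , b
balanced-split (ρ i j e) S t 1≤t t< with s , b ← balanced-split e S t 1≤t t< =
  inside-ρ i j s , b

Thirds : ∀ {k} (e : Expr k) → (Vertex e → Bool) → Split e → Set
Thirds e S s = 3 * weight e (S ∩ side s) ≤ 2 * weight e S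
             × 3 * weight e (S ∖ side s) ≤ 2 * weight e S

thirds-split : ∀ {k} (e : Expr k) S → 1 < weight e S → ∃ (Thirds e S)
thirds-split e S 1<m = s , 3in≤ , 3out≤
  where
  open ≤-Reasoning
  open +-*-Solver using (_:*_; _:+_; _:=_; con)
  m = weight e S
  -- The inside may hold at most two thirds, rounded down; `Balanced` then gives it at least one
  -- third, so the outside is bounded as well.
  t = 2 * m / 3

  1≤t : 1 ≤ t
  1≤t = m≥n⇒m/n>0 (≤-trans (n≤1+n 3) (*-monoʳ-≤ 2 1<m))

  t<m : t < m
  t<m = m<n*o⇒m/o<n (subst (2 * m <_) (*-comm 3 m)
          (*-monoˡ-< m {{>-nonZero (<-trans 0<1+n 1<m)}} (n<1+n 2)))

  split = balanced-split e S t 1≤t t<m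
  s   = proj₁ split
  in≤ = proj₁ (proj₂ split)
  <in = proj₂ (proj₂ split)
  a = weight e (S ∩ side s)
  b = weight e (S ∖ side s)

  3in≤ : 3 * a ≤ 2 * m
  3in≤ = begin
    3 * a          ≡⟨ *-comm 3 a ⟩
    a * 3          ≤⟨ *-monoˡ-≤ 3 in≤ ⟩
    2 * m / 3 * 3  ≤⟨ m/n*n≤m (2 * m) 3 ⟩
    2 * m          ∎

  2m≤6a : 2 * m ≤ 2 * a * 3
  -- This undoes the rounding: `6a < 2m` would give `2a ≤ t`, against `t < 2a`.
  2m≤6a = ≮⇒≥ λ 6a<2m → <⇒≱ <in (begin
    2 * a          ≡⟨ m*n/n≡m (2 * a) 3 ⟨
    2 * a * 3 / 3  ≤⟨ /-monoˡ-≤ 3 (<⇒≤ 6a<2m) ⟩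
    2 * m / 3      ∎)

  m≤3a : m ≤ 3 * a
  m≤3a = *-cancelˡ-≤ 2 (begin
    2 * m        ≤⟨ 2m≤6a ⟩
    2 * a * 3    ≡⟨ +-*-Solver.solve 1 (λ a → con 2 :* a :* con 3 := con 2 :* (con 3 :* a)) refl a ⟩
    2 * (3 * a)  ∎)

  3out≤ : 3 * b ≤ 2 * m
  3out≤ = +-cancelˡ-≤ m (3 * b) (2 * m) (begin
    m + 3 * b      ≤⟨ +-monoˡ-≤ (3 * b) m≤3a ⟩
    3 * a + 3 * b  ≡⟨ *-distribˡ-+ 3 a b ⟨
    3 * (a + b)    ≡⟨ cong (3 *_) (weight-∩-∖ e S (side s)) ⟩
    m + 2 * m      ∎)

-- Words of one level and the decoder.

meets : ∀ {k} → Vec Bool k → Vec Bool k → Bool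
meets []       []       = false
meets (x ∷ xs) (y ∷ ys) = (x ∧ y) ∨ meets xs ys

-- The symmetry lets the decoder test two words without finding out which of them is the one-hot
-- one.
meets-comm : ∀ {k} (xs ys : Vec Bool k) → meets xs ys ≡ meets ys xs
meets-comm []       []       = refl
meets-comm (x ∷ xs) (y ∷ ys) = cong₂ _∨_ (∧-comm x y) (meets-comm xs ys)

meets-∅ˡ : ∀ {k} (xs : Vec Bool k) → meets (replicate k false) xs ≡ false
meets-∅ˡ []       = refl
meets-∅ˡ (_ ∷ xs) = meets-∅ˡ xs

-- An expression may use `w` labels with `w` below `k`. Padding gives all graphs of the family the
-- same label length and the same decoder.
meets-padRight : ∀ {w k} (w≤k : w ≤ k) xs ys →
                 meets (padRight w≤k false xs) (padRight w≤k false ys) ≡ meets xs ys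
meets-padRight {k = k} z≤n [] []           = meets-∅ˡ (replicate k false)
meets-padRight (s≤s w≤k) (x ∷ xs) (y ∷ ys) = cong (x ∧ y ∨_) (meets-padRight w≤k xs ys)

one-hot : ∀ {k} → Fin k → Vec Bool k
one-hot {suc k} zero    = true ∷ replicate k false
one-hot         (suc i) = false ∷ one-hot i

meets-one-hot : ∀ {k} (i : Fin k) f → meets (one-hot i) (tabulate f) ≡ f i
meets-one-hot zero    f = trans (cong (f zero ∨_) (meets-∅ˡ (tabulate (f ∘ suc)))) (∨-identityʳ _)
meets-one-hot (suc i) f = meets-one-hot i (f ∘ suc)

-- A level is a block of `suc k` bits, the side bit followed by a word. The first level at which the
-- side bits differ decides. If there is none, the two vertices coincide, hence the default `false`.
decode : ∀ k h → Vec Bool (h * suc k) → Vec Bool (h * suc k) → Bool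
decode k zero    _        _        = false
decode k (suc h) (x ∷ xs) (y ∷ ys) =
  if x xor y then meets (take k xs) (take k ys) else decode k h (drop k xs) (drop k ys)

take-++ : ∀ {A : Set} {m n} (xs : Vec A m) (ys : Vec A n) → take m (xs ++ ys) ≡ xs
take-++ {m = m} xs ys = ++-injectiveˡ (take m (xs ++ ys)) xs (take++drop≡id m (xs ++ ys))

drop-++ : ∀ {A : Set} {m n} (xs : Vec A m) (ys : Vec A n) → drop m (xs ++ ys) ≡ ys
drop-++ {m = m} xs ys = ++-injectiveʳ (take m (xs ++ ys)) xs (take++drop≡id m (xs ++ ys))

decode-suc : ∀ k h x y (xs ys : Vec Bool k) (us vs : Vec Bool (h * suc k)) →
             decode k (suc h) (x ∷ xs ++ us) (y ∷ ys ++ vs) ≡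
             (if x xor y then meets xs ys else decode k h us vs)
decode-suc k h x y xs ys us vs
  rewrite take-++ xs us | take-++ ys vs | drop-++ xs us | drop-++ ys vs = refl

-- The recursive encoding.

scale-down : ∀ h m x → 3 * x ≤ 2 * m → m * 2 ^ suc h ≤ 3 ^ suc h → x * 2 ^ h ≤ 3 ^ h
scale-down h m x 3x≤2m m≤ = *-cancelˡ-≤ 3 (begin
  3 * (x * 2 ^ h)    ≡⟨ *-assoc 3 x (2 ^ h) ⟨
  3 * x * 2 ^ h      ≤⟨ *-monoˡ-≤ (2 ^ h) 3x≤2m ⟩
  2 * m * 2 ^ h      ≡⟨ +-*-Solver.solve 2 (λ m p → con 2 :* m :* p := m :* (con 2 :* p)) refl m (2 ^ h) ⟩
  m * (2 * 2 ^ h)    ≤⟨ m≤ ⟩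
  3 * 3 ^ h          ∎)
  where
  open ≤-Reasoning
  open +-*-Solver using (_:*_; _:=_; con)

module _ {w k} (w≤k : w ≤ k) (e : Expr w)
         (edge-sym : ∀ u v → edge e u v ≡ edge e v u)
         (edge-irrefl : ∀ v → edge e v v ≡ false) where

  Encoding : ℕ → (Vertex e → Bool) → Set
  Encoding h S = Σ (Vertex e → Vec Bool (h * suc k)) λ code →
    ∀ u v → S u ≡ true → S v ≡ true → edge e u v ≡ decode k h (code u) (code v)

  pad : Vec Bool w → Vec Bool k
  pad = padRight w≤k false

  -- The hypothesis says that `S` has at most (3/2)^h vertices. Both parts of a thirds split have at
  -- most two thirds of the weight, so they satisfy it for one level less.
  encoding : ∀ h S → weight e S * 2 ^ h ≤ 3 ^ h → Encoding h S
  encoding zero S m≤ = const [] , λ u v Su Sv →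
    trans (cong (edge e u) (sym (weight≤1⇒≡ e (subst (_≤ 1) (*-identityʳ _) m≤) u v Su Sv)))
          (edge-irrefl u)
  encoding (suc h) S m≤ with weight e S ≤? 1
  ... | yes m≤1 = code , correct
    where
    rest = encoding h S (≤-trans (*-monoˡ-≤ (2 ^ h) m≤1)
             (subst (_≤ 3 ^ h) (sym (*-identityˡ (2 ^ h))) (^-monoˡ-≤ h (n≤1+n 2))))

    code : Vertex e → Vec Bool (suc h * suc k)
    -- A dummy level keeps the length fixed when a branch shrinks early: all side bits agree, so the
    -- decoder passes on to the next level.
    code u = false ∷ replicate k false ++ proj₁ rest u

    correct : ∀ u v → S u ≡ true → S v ≡ true → edge e u v ≡ decode k (suc h) (code u) (code v)
    correct u v Su Sv = trans (proj₂ rest u v Su Sv)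
      (sym (decode-suc k h false false (replicate k false) (replicate k false) _ _))
  ... | no m≰1 = code , correct
    where
    split = thirds-split e S (≰⇒> m≰1)
    s = proj₁ split
    inner = encoding h (S ∩ side s) (scale-down h (weight e S) (weight e (S ∩ side s)) (proj₁ (proj₂ split)) m≤)
    outer = encoding h (S ∖ side s) (scale-down h (weight e S) (weight e (S ∖ side s)) (proj₂ (proj₂ split)) m≤)

    -- The side bit is an argument of its own so that `by-sides` can match on it while keeping the
    -- equation with `side s u`.
    word : Vertex e → Bool → Vec Bool k
    word u b = pad (if b then one-hot (class s u) else tabulate (neighbour s u))

    rest : Vertex e → Bool → Vec Bool (h * suc k)
    rest u b = if b then proj₁ inner u else proj₁ outer u

    code : Vertex e → Vec Bool (suc h * suc k)
    code u = side s u ∷ word u (side s u) ++ rest u (side s u)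

    crossing : ∀ u v → side s u ≡ true → side s v ≡ false →
               edge e u v ≡ meets (word u true) (word v false)
    crossing u v u∈ v∉ = begin
      edge e u v                  ≡⟨ edge-class s u v u∈ v∉ ⟩
      neighbour s v (class s u)   ≡⟨ meets-one-hot (class s u) (neighbour s v) ⟨
      meets (one-hot (class s u)) (tabulate (neighbour s v)) ≡⟨ meets-padRight w≤k _ _ ⟨
      meets (word u true) (word v false) ∎
      where open ≡-Reasoning

    by-sides : ∀ u v x y → side s u ≡ x → side s v ≡ y → S u ≡ true → S v ≡ true →
               edge e u v ≡
               (if x xor y then meets (word u x) (word v y) else decode k h (rest u x) (rest v y))
    by-sides u v true  true  u∈ v∈ Su Sv = proj₂ inner u v (cong₂ _∧_ Su u∈) (cong₂ _∧_ Sv v∈)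
    by-sides u v true  false u∈ v∉ Su Sv = crossing u v u∈ v∉
    by-sides u v false true  u∉ v∈ Su Sv =
      trans (edge-sym u v) (trans (crossing v u v∈ u∉) (meets-comm (word v true) (word u false)))
    by-sides u v false false u∉ v∉ Su Sv =
      proj₂ outer u v (cong₂ (λ a b → a ∧ not b) Su u∉) (cong₂ (λ a b → a ∧ not b) Sv v∉)

    correct : ∀ u v → S u ≡ true → S v ≡ true → edge e u v ≡ decode k (suc h) (code u) (code v)
    correct u v Su Sv = trans (by-sides u v _ _ refl refl Su Sv)
      (sym (decode-suc k h (side s u) (side s v) (word u (side s u)) (word v (side s v)) _ _))

-- From expressions to labels for graphs on `Fin n`.

size : ∀ {k} → Expr k → ℕ
size e = weight e (const true)

Fin-size↔Vertex : ∀ {k} (e : Expr k) → Fin (size e) ↔ Vertex e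
Fin-size↔Vertex (vertex _)  = 1↔⊤
Fin-size↔Vertex (d ⊕ e)     = ↔-trans +↔⊎ (Fin-size↔Vertex d ⊎-↔ Fin-size↔Vertex e)
Fin-size↔Vertex (η _ _ _ e) = Fin-size↔Vertex e
Fin-size↔Vertex (ρ _ _ e)   = Fin-size↔Vertex e

-- The labels form a vector rather than a function, so that the candidates can be searched
-- exhaustively.
Labels : ∀ {n L} → (Vec Bool L → Vec Bool L → Bool) → Graph (Fin n) → Vec (Vec Bool L) n → Set
Labels dec G t = ∀ u v → adj G u v ≡ dec (lookup t u) (lookup t v)

constructible⇒labels : ∀ {w k n} h (G : Graph (Fin n)) → w ≤ k → n * 2 ^ h ≤ 3 ^ h →
                       Constructible w G → ∃ (Labels (decode k h) G)
constructible⇒labels {w} {k} {n} h G w≤k n≤ (e , f , edge≡adj) = tabulate (code ∘ from) , correct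
  where
  open Inverse f
  open ≡-Reasoning

  adj≡edge : ∀ u v → adj G u v ≡ edge e (from u) (from v)
  adj≡edge u v = sym (trans (edge≡adj (from u) (from v))
    (cong₂ (adj G) (strictlyInverseˡ u) (strictlyInverseˡ v)))

  -- Symmetry and irreflexivity are pulled back from `G` along the bijection.
  edge-sym : ∀ u v → edge e u v ≡ edge e v u
  edge-sym u v = trans (edge≡adj u v) (trans (symmetric G _ _) (sym (edge≡adj v u)))

  edge-irrefl : ∀ v → edge e v v ≡ false
  edge-irrefl v = trans (edge≡adj v v) (irreflexive G _)

  enc : Encoding w≤k e edge-sym edge-irrefl h (const true)
  enc = encoding w≤k e edge-sym edge-irrefl h (const true)
    (subst (λ m → m * 2 ^ h ≤ 3 ^ h) (sym (↔⇒≡ (↔-trans (Fin-size↔Vertex e) f))) n≤)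
  code = proj₁ enc

  correct : Labels (decode k h) G (tabulate (code ∘ from))
  correct u v = begin
    adj G u v                                      ≡⟨ adj≡edge u v ⟩
    edge e (from u) (from v)                       ≡⟨ proj₂ enc _ _ refl refl ⟩
    decode k h (code (from u)) (code (from v))
      ≡⟨ cong₂ (decode k h) (lookup∘tabulate (code ∘ from) u) (lookup∘tabulate (code ∘ from) v) ⟨
    decode k h (lookup (tabulate (code ∘ from)) u) (lookup (tabulate (code ∘ from)) v) ∎

-- Exhaustive search for labels.

any-vec? : {A : Set} → (∀ {P : A → Set} → Decidable P → Dec (∃ P)) →
           ∀ {n} {P : Vec A n → Set} → Decidable P → Dec (∃ P)
any-vec? any? {zero}  P? = map′ ([] ,_) (λ { ([] , p) → p }) (P? [])
any-vec? any? {suc n} P? =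
  map′ (λ (x , xs , p) → x ∷ xs , p) (λ { (x ∷ xs , p) → x , xs , p })
       (any? λ x → any-vec? any? (P? ∘ (x ∷_)))

labels? : ∀ {n L} (dec : Vec Bool L → Vec Bool L → Bool) (G : Graph (Fin n)) → Dec (∃ (Labels dec G))
-- A subset of `Fin L` is a `Vec Bool L`, so `anySubset?` searches the possible labels of one
-- vertex.
labels? dec G = any-vec? anySubset? λ t → Fin.all? λ u → Fin.all? λ v → adj G u v Bool.≟ _

-- Membership in F is irrelevant in enc, so it only certifies that the search
-- for labels among the finitely many candidates succeeds.
searchScheme : ∀ {n L} {F : Graph (Fin n) → Set} (dec : Vec Bool L → Vec Bool L → Bool) →
               (∀ G → F G → ∃ (Labels dec G)) → LabelingScheme F L
searchScheme dec labels = record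
  { enc     = λ G G∈F → lookup (proj₁ (recompute (labels? dec G) (labels G G∈F)))
  ; dec     = dec
  ; correct = λ G G∈F → proj₂ (recompute (labels? dec G) (labels G G∈F))
  }

-- Clique-width one.

edge-1 : ∀ (e : Expr 1) u v → edge e u v ≡ false
edge-1 (vertex _)         _        _        = refl
edge-1 (d ⊕ e)            (inj₁ u) (inj₁ v) = edge-1 d u v
edge-1 (d ⊕ e)            (inj₂ u) (inj₂ v) = edge-1 e u v
edge-1 (d ⊕ e)            (inj₁ _) (inj₂ _) = refl
edge-1 (d ⊕ e)            (inj₂ _) (inj₁ _) = refl
-- A join requires two distinct labels, so one label never creates an edge.
edge-1 (η zero zero i≢i e) _       _        = contradiction refl i≢i
edge-1 (ρ _ _ e)          u        v        = edge-1 e u v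

¬Expr-0 : ¬ Expr 0
¬Expr-0 (vertex ())
¬Expr-0 (d ⊕ _)   = ¬Expr-0 d
¬Expr-0 (ρ _ _ e) = ¬Expr-0 e
¬Expr-0 (η _ _ _ e) = ¬Expr-0 e

constructible⇒1≤ : ∀ {w V} (G : Graph V) → Constructible w G → 1 ≤ w
constructible⇒1≤ {zero}  _ (e , _) = ⊥-elim (¬Expr-0 e)
constructible⇒1≤ {suc _} _ _       = s≤s z≤n

constructible-1⇒edgeless : ∀ {V} (G : Graph V) → Constructible 1 G → ∀ u v → adj G u v ≡ false
constructible-1⇒edgeless G (e , f , edge≡adj) u v = begin
  adj G u v                             ≡⟨ cong₂ (adj G) (strictlyInverseˡ u) (strictlyInverseˡ v) ⟨
  adj G (to (from u)) (to (from v))     ≡⟨ edge≡adj (from u) (from v) ⟨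
  edge e (from u) (from v)              ≡⟨ edge-1 e (from u) (from v) ⟩
  false                                 ∎
  where
  open Inverse f
  open ≡-Reasoning

-- Since log₂ 1 = 0, the upper bound leaves no bits at all for `k = 1`.
edgelessScheme : ∀ n → LabelingScheme (𝒞 1 n) 0
edgelessScheme n = record
  { enc     = λ _ _ _ → []
  ; dec     = λ _ _ → false
  ; correct = λ { G (w , (con , _) , w≤1) →
      constructible-1⇒edgeless G (subst (λ w → Constructible w G) (≤-antisym w≤1 (constructible⇒1≤ G con)) con) }
  }

-- Number of levels.

-- The exponent `g` is log₂ n rounded up. Comparison with `n ^ 2` absorbs the rounding and still
-- forces `g = 0` at `n = 1`, where the upper bound vanishes.
power-between : ∀ n → 1 ≤ n → ∃ λ g → n ≤ 2 ^ g × 2 ^ g ≤ n ^ 2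
power-between 1 _ = 0 , ≤-refl , ≤-refl
power-between (suc n@(suc _)) _ with power-between n (s≤s z≤n)
... | g , n≤ , ≤n² with suc n ≤? 2 ^ g
... | yes n< = g , n< , ≤-trans ≤n² (^-monoˡ-≤ 2 (n≤1+n n))
... | no  n≮ = suc g , ≤-trans (≤-reflexive (+-comm 1 n)) (≤-trans (+-mono-≤ n≤ 1≤2^g) ≡2*)
             , *-mono-≤ {2} {suc n} (s≤s (s≤s z≤n)) (≤-trans (<⇒≤ (≰⇒> n≮)) (≤-reflexive (sym (*-identityʳ _))))
  where
  1≤2^g : 1 ≤ 2 ^ g
  1≤2^g = m^n>0 2 g
  ≡2* : 2 ^ g + 2 ^ g ≤ 2 ^ suc g
  ≡2* = ≤-reflexive (cong (2 ^ g +_) (sym (+-identityʳ _)))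

2^g*4^g≤9^g : ∀ g → 2 ^ g * 4 ^ g ≤ 9 ^ g
2^g*4^g≤9^g zero    = ≤-refl
2^g*4^g≤9^g (suc g) = begin
  2 * 2 ^ g * (4 * 4 ^ g)  ≡⟨ +-*-Solver.solve 2 (λ x y → con 2 :* x :* (con 4 :* y) := con 8 :* (x :* y)) refl (2 ^ g) (4 ^ g) ⟩
  8 * (2 ^ g * 4 ^ g)      ≤⟨ *-mono-≤ (n≤1+n 8) (2^g*4^g≤9^g g) ⟩
  9 * 9 ^ g                ∎
  where
  open ≤-Reasoning
  open +-*-Solver using (_:*_; _:=_; con)

-- Two levels shrink a set to at most 4/9 of its weight, which is less than half; so `2 * g` levels
-- make up for `g` doublings.
enough-levels : ∀ g {n} → n ≤ 2 ^ g → n * 2 ^ (2 * g) ≤ 3 ^ (2 * g)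
enough-levels g {n} n≤ = begin
  n * 2 ^ (2 * g)  ≡⟨ cong (n *_) (^-*-assoc 2 2 g) ⟨
  n * 4 ^ g        ≤⟨ *-monoˡ-≤ (4 ^ g) n≤ ⟩
  2 ^ g * 4 ^ g    ≤⟨ 2^g*4^g≤9^g g ⟩
  9 ^ g            ≡⟨ ^-*-assoc 3 2 g ⟩
  3 ^ (2 * g)      ∎
  where open ≤-Reasoning

-- Rational bounds on logarithms.

2^-cancel-≤ : ∀ {x y} → 2 ^ x ≤ 2 ^ y → x ≤ y
2^-cancel-≤ 2^x≤2^y = ≮⇒≥ λ y<x → <⇒≱ (^-monoʳ-< 2 ≤-refl y<x) 2^x≤2^y

-- This is g ≤ log₂ m ≤ a / b with logarithms and denominators cleared.
≥log₂⇒numerator≥ : ∀ {m} g a b → 2 ^ g ≤ m → m ^ b ≤ 2 ^ a → g * b ≤ a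
≥log₂⇒numerator≥ {m} g a b 2^g≤m m^b≤ = 2^-cancel-≤ (begin
  2 ^ (g * b)  ≡⟨ ^-*-assoc 2 g b ⟨
  (2 ^ g) ^ b  ≤⟨ ^-monoˡ-≤ b 2^g≤m ⟩
  m ^ b        ≤⟨ m^b≤ ⟩
  2 ^ a        ∎)
  where open ≤-Reasoning

≤log₂⇒numerator≤ : ∀ {m} g a b → m ≤ 2 ^ g → 2 ^ a ≤ m ^ b → a ≤ g * b
≤log₂⇒numerator≤ {m} g a b m≤2^g ≤m^b = 2^-cancel-≤ (begin
  2 ^ a        ≤⟨ ≤m^b ⟩
  m ^ b        ≤⟨ ^-monoˡ-≤ b m≤2^g ⟩
  (2 ^ g) ^ b  ≡⟨ ^-*-assoc 2 g b ⟩
  2 ^ (g * b)  ∎)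
  where open ≤-Reasoning

square-≥log₂ : ∀ m a b → m ^ b ≤ 2 ^ a → (m ^ 2) ^ b ≤ 2 ^ (a * 2)
square-≥log₂ m a b m^b≤ = begin
  (m ^ 2) ^ b  ≡⟨ ^-*-assoc m 2 b ⟩
  m ^ (2 * b)  ≡⟨ cong (m ^_) (*-comm 2 b) ⟩
  m ^ (b * 2)  ≡⟨ ^-*-assoc m b 2 ⟨
  (m ^ b) ^ 2  ≤⟨ ^-monoˡ-≤ 2 m^b≤ ⟩
  (2 ^ a) ^ 2  ≡⟨ ^-*-assoc 2 a 2 ⟩
  2 ^ (a * 2)  ∎
  where open ≤-Reasoning

-- For `m ≥ 1` the logarithm is nonnegative, so it has no negative upper bound.
negative-≱log₂ : ∀ m a b → 1 ≤ m → ¬ (m ^ b * 2 ^ suc a ≤ 1)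
negative-≱log₂ m a b 1≤m ≤1 = <⇒≱ (s≤s (s≤s z≤n)) (begin
  2                ≤⟨ *-monoʳ-≤ 2 (m^n>0 2 a) ⟩
  2 ^ suc a        ≡⟨ *-identityˡ _ ⟨
  1 * 2 ^ suc a    ≤⟨ *-monoˡ-≤ (2 ^ suc a) (m^n>0 m {{>-nonZero 1≤m}} b) ⟩
  m ^ b * 2 ^ suc a ≤⟨ ≤1 ⟩
  1                ∎)
  where open ≤-Reasoning

n<2^n : ∀ n → n < 2 ^ n
n<2^n zero    = s≤s z≤n
n<2^n (suc n) = ≤-trans (+-mono-≤ (m^n>0 2 n) (n<2^n n))
                  (≤-reflexive (cong (2 ^ n +_) (sym (+-identityʳ _))))

numerator-product : ∀ x y z t →
                    ((ℤ.+ x ℤ.* ℤ.+ y) ℤ.* ℤ.+ z) ℤ.* ℤ.+ t ≡ ℤ.+ (x * y * z * t)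
numerator-product x y z t
  rewrite sym (ℤ.pos-* x y) | sym (ℤ.pos-* (x * y) z) | sym (ℤ.pos-* (x * y * z) t) = refl

module _ {L c d k a b a′ b′ : ℕ} where

  private
    product = mkℚᵘ (ℤ.+ c) d ℚᵘ.* fromℕ k ℚᵘ.* mkℚᵘ (ℤ.+ a) b ℚᵘ.* mkℚᵘ (ℤ.+ a′) b′
    num = c * k * a * a′
    den = suc d * 1 * suc b * suc b′

  fromℕ≤product : L * den ≤ num → fromℕ L ℚᵘ.≤ product
  fromℕ≤product L≤ = ℚᵘ.*≤* (subst₂ ℤ._≤_ (ℤ.pos-* L den)
    (sym (trans (ℤ.*-identityʳ _) (numerator-product c k a a′))) (ℤ.+≤+ L≤))

  product≤fromℕ : num ≤ L * den → product ℚᵘ.≤ fromℕ L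
  product≤fromℕ ≤L = ℚᵘ.*≤* (subst₂ ℤ._≤_
    (sym (trans (ℤ.*-identityʳ _) (numerator-product c k a a′))) (ℤ.pos-* L den) (ℤ.+≤+ ≤L))

atMostLogs-0 : ∀ {a b} c d k → 1 ≤ a → 1 ≤ b →
               AtMostLogs (mkℚᵘ (ℤ.+ c) d ℚᵘ.* fromℕ k) a b 0
atMostLogs-0 c d k _ _ (mkℚᵘ (ℤ.+ x) x′) (mkℚᵘ (ℤ.+ y) y′) _ _ =
  fromℕ≤product {0} {c} {d} {k} {x} {x′} {y} {y′} z≤n
atMostLogs-0 {a} {b} c d k 1≤a _ (mkℚᵘ -[1+ x ] x′) _ p≥ _ =
  contradiction p≥ (negative-≱log₂ a x (suc x′) 1≤a)
atMostLogs-0 {a} {b} c d k _ 1≤b _ (mkℚᵘ -[1+ y ] y′) _ q≥ =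
  contradiction q≥ (negative-≱log₂ b y (suc y′) 1≤b)

-- The constant 8 collects three factors of 2: two levels per unit of `g`, `suc k ≤ 2 * k`, and g ≤
-- 2 log₂ n. The factor log₂ k comes for free, being at least 1.
atMostLogs : ∀ {k n} g → 2 ≤ k → 1 ≤ n → 2 ^ g ≤ n ^ 2 →
             AtMostLogs (mkℚᵘ (ℤ.+ 8) 0 ℚᵘ.* fromℕ k) k n (2 * g * suc k)
atMostLogs {k} g 2≤k _ _ (mkℚᵘ -[1+ a ] b) _ p≥ _ =
  contradiction p≥ (negative-≱log₂ k a (suc b) (≤-trans (n≤1+n 1) 2≤k))
atMostLogs {k} {n} g _ 1≤n _ _ (mkℚᵘ -[1+ a ] b) _ q≥ =
  contradiction q≥ (negative-≱log₂ n a (suc b) 1≤n)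
atMostLogs {k} {n} g 2≤k _ 2^g≤ (mkℚᵘ (ℤ.+ a) b) (mkℚᵘ (ℤ.+ a′) b′) p≥ q≥ =
  fromℕ≤product {2 * g * suc k} {8} {0} {k} {a} {b} {a′} {b′} (begin
    2 * g * suc k * (1 * suc b * suc b′)
      ≤⟨ *-monoˡ-≤ (1 * suc b * suc b′) (*-monoʳ-≤ (2 * g) 1+k≤2k) ⟩
    2 * g * (2 * k) * (1 * suc b * suc b′)
      ≡⟨ +-*-Solver.solve 4 (λ g k b b′ →
           con 2 :* g :* (con 2 :* k) :* (con 1 :* b :* b′) := con 4 :* k :* b :* (g :* b′))
           refl g k (suc b) (suc b′) ⟩
    4 * k * suc b * (g * suc b′)
      ≤⟨ *-mono-≤ (*-monoʳ-≤ (4 * k) b≤a) gb′≤2a′ ⟩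
    4 * k * a * (a′ * 2)
      ≡⟨ +-*-Solver.solve 3 (λ k a a′ →
           con 4 :* k :* a :* (a′ :* con 2) := con 8 :* k :* a :* a′) refl k a a′ ⟩
    8 * k * a * a′ ∎)
  where
  open ≤-Reasoning
  open +-*-Solver using (_:*_; _:=_; con)

  1+k≤2k : suc k ≤ 2 * k
  1+k≤2k = ≤-trans (+-monoˡ-≤ k (≤-trans (n≤1+n 1) 2≤k)) (≤-reflexive (cong (k +_) (sym (+-identityʳ k))))

  b≤a : suc b ≤ a
  b≤a = subst (_≤ a) (*-identityˡ (suc b)) (≥log₂⇒numerator≥ 1 a (suc b) 2≤k p≥)

  gb′≤2a′ : g * suc b′ ≤ a′ * 2
  gb′≤2a′ = ≥log₂⇒numerator≥ g (a′ * 2) (suc b′) 2^g≤ (square-≥log₂ n a′ (suc b′) q≥)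

-- The constant is 1 / (suc K)², stored with its denominator less one. It offsets k ≤ suc K and log₂
-- k ≤ suc K, which leaves log₂ n ≤ L.
atLeastLogs : ∀ {K k n L} → 1 ≤ k → k ≤ suc K → (2 ≤ k → n ≤ 2 ^ L) →
              AtLeastLogs (mkℚᵘ (ℤ.+ 1) (K + K * suc K) ℚᵘ.* fromℕ k) k n L
atLeastLogs _ _ _ (mkℚᵘ -[1+ _ ] _) _ (ℚᵘ.*≤* ()) _ _ _
atLeastLogs _ _ _ (mkℚᵘ (ℤ.+ _) _) (mkℚᵘ -[1+ _ ] _) _ (ℚᵘ.*≤* ()) _ _
-- A nonnegative rational below log₂ 1 is zero, so the product vanishes.
atLeastLogs {K} {1} {n} {L} _ _ _ (mkℚᵘ (ℤ.+ a) b) (mkℚᵘ (ℤ.+ a′) b′) _ _ p≤ _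
  with z≤n ← ≤log₂⇒numerator≤ 0 a (suc b) (s≤s z≤n) p≤ =
  product≤fromℕ {L} {1} {K + K * suc K} {1} {0} {b} {a′} {b′} z≤n
atLeastLogs {K} {k@(suc (suc _))} {n} {L} _ k≤K n≤ (mkℚᵘ (ℤ.+ a) b) (mkℚᵘ (ℤ.+ a′) b′) _ _ p≤ q≤ =
  product≤fromℕ {L} {1} {K + K * suc K} {k} {a} {b} {a′} {b′} (begin
    1 * k * a * a′
      ≤⟨ *-mono-≤ (*-mono-≤ (*-monoʳ-≤ 1 k≤K) a≤) a′≤ ⟩
    1 * suc K * (suc K * suc b) * (L * suc b′)
      ≡⟨ +-*-Solver.solve 4 (λ K b L b′ →
           con 1 :* K :* (K :* b) :* (L :* b′) := L :* (K :* K :* con 1 :* b :* b′))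
           refl (suc K) (suc b) L (suc b′) ⟩
    L * (suc K * suc K * 1 * suc b * suc b′) ∎)
  where
  open ≤-Reasoning
  open +-*-Solver using (_:*_; _:=_; con)

  a≤ : a ≤ suc K * suc b
  a≤ = ≤log₂⇒numerator≤ (suc K) a (suc b) (≤-trans k≤K (<⇒≤ (n<2^n (suc K)))) p≤

  a′≤ : a′ ≤ L * suc b′
  a′≤ = ≤log₂⇒numerator≤ L a′ (suc b′) (n≤ (s≤s (s≤s z≤n))) q≤

-- Complete graphs and the lower bound.

completeGraph : ∀ n → Graph (Fin n)
completeGraph n = record
  { adj         = λ u v → not (does (u ≟ v))
  ; symmetric   = λ u v → cong not (does-≟-sym u v)
  ; irreflexive = λ v → cong not (dec-true (v ≟ v) refl)
  }
  where
  does-≟-sym : ∀ {n} (u v : Fin n) → does (u ≟ v) ≡ does (v ≟ u)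
  does-≟-sym u v with u ≟ v
  ... | yes u≡v = sym (dec-true (v ≟ u) (sym u≡v))
  ... | no  u≢v = sym (dec-false (v ≟ u) (u≢v ∘ sym))

-- The earlier vertices all have label 0. A new one enters with label 1, is joined to them and then
-- relabeled to 0, so two labels are enough.
clique : ℕ → Expr 2
clique zero    = vertex 0F
clique (suc n) = ρ 1F 0F (η 0F 1F (λ ()) (vertex 1F ⊕ clique n))

size-clique : ∀ n → size (clique n) ≡ suc n
size-clique zero    = refl
size-clique (suc n) = cong suc (size-clique n)

label-clique : ∀ n v → label (clique n) v ≡ 0F
label-clique zero    _        = refl
label-clique (suc n) (inj₁ _) = refl
label-clique (suc n) (inj₂ v) rewrite label-clique n v = refl

edge-clique : ∀ n u v → u ≢ v → edge (clique n) u v ≡ true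
edge-clique zero    _        _        u≢v = contradiction refl u≢v
edge-clique (suc n) (inj₁ _) (inj₁ _) u≢v = contradiction refl u≢v
edge-clique (suc n) (inj₁ _) (inj₂ v) _ rewrite label-clique n v = refl
edge-clique (suc n) (inj₂ u) (inj₁ _) _ rewrite label-clique n u = refl
edge-clique (suc n) (inj₂ u) (inj₂ v) u≢v
  rewrite edge-clique n u v (u≢v ∘ cong inj₂) = refl

edge-clique-irrefl : ∀ n v → edge (clique n) v v ≡ false
edge-clique-irrefl zero    _        = refl
edge-clique-irrefl (suc n) (inj₁ _) = refl
edge-clique-irrefl (suc n) (inj₂ v)
  rewrite edge-clique-irrefl n v | label-clique n v = refl

completeGraph-constructible : ∀ n → Constructible 2 (completeGraph (suc n))
completeGraph-constructible n = clique n , f , edge≡adj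
  where
  f : Vertex (clique n) ↔ Fin (suc n)
  f = subst (λ m → Vertex (clique n) ↔ Fin m) (size-clique n) (↔-sym (Fin-size↔Vertex (clique n)))
  open Inverse f

  edge≡adj : ∀ u v → edge (clique n) u v ≡ not (does (to u ≟ to v))
  edge≡adj u v with to u ≟ to v
  ... | no  fu≢fv = edge-clique n u v (fu≢fv ∘ cong to)
  ... | yes fu≡fv rewrite Injection.injective (↔⇒↣ f) fu≡fv = edge-clique-irrefl n v

-- `𝒞` refers to the exact clique-width, so minimality has to be shown: one label would leave the
-- vertices `0F` and `1F` nonadjacent.
completeGraph-cliqueWidth : ∀ n → IsCliqueWidth (completeGraph (2 + n)) 2
completeGraph-cliqueWidth n = completeGraph-constructible (suc n) , minimal
  where
  minimal : ∀ w → Constructible w (completeGraph (2 + n)) → 2 ≤ w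
  minimal 0             con = contradiction (constructible⇒1≤ (completeGraph (2 + n)) con) λ ()
  minimal 1             con = contradiction (constructible-1⇒edgeless (completeGraph (2 + n)) con 0F 1F) λ ()
  minimal (suc (suc _)) _   = s≤s (s≤s z≤n)

bits→Fin : ∀ {L} → Vec Bool L → Fin (2 ^ L)
bits→Fin []       = zero
bits→Fin (x ∷ xs) = combine (Inverse.from 2↔Bool x) (bits→Fin xs)

bits→Fin-injective : ∀ {L} → Injective _≡_ _≡_ (bits→Fin {L})
bits→Fin-injective {x = []}     {[]}     _  = refl
bits→Fin-injective {x = x ∷ xs} {y ∷ ys} eq
  with x≡y , xs≡ys ← combine-injective (Inverse.from 2↔Bool x) (bits→Fin xs) _ (bits→Fin ys) eq =
  cong₂ _∷_ (Injection.injective (↔⇒↣ (↔-sym 2↔Bool)) x≡y) (bits→Fin-injective xs≡ys)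

scheme⇒≤2^ : ∀ {n L} {F : Graph (Fin n) → Set} → F (completeGraph n) → LabelingScheme F L → n ≤ 2 ^ L
scheme⇒≤2^ {n} F∋K scheme = injective⇒≤ {f = bits→Fin ∘ enc K F∋K} (enc-injective ∘ bits→Fin-injective)
  where
  open LabelingScheme scheme
  K = completeGraph n

  enc-injective : ∀ {u v} → enc K F∋K u ≡ enc K F∋K v → u ≡ v
  enc-injective {u} {v} eq with u ≟ v in u≟v
  ... | yes u≡v = u≡v
  ... | no  _   = contradiction (begin
    true                             ≡⟨ cong (not ∘ does) u≟v ⟨
    adj K u v                        ≡⟨ correct K F∋K u v ⟩
    dec (enc K F∋K u) (enc K F∋K v)  ≡⟨ cong (λ l → dec l (enc K F∋K v)) eq ⟩
    dec (enc K F∋K v) (enc K F∋K v)  ≡⟨ correct K F∋K v v ⟨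
    adj K v v                        ≡⟨ irreflexive K v ⟩
    false                            ∎) λ ()
    where open ≡-Reasoning

𝒞-scheme⇒≤2^ : ∀ {k n L} → 2 ≤ k → LabelingScheme (𝒞 k n) L → n ≤ 2 ^ L
-- Complete graphs on fewer than two vertices do not have clique-width 2, but there the bound is
-- immediate.
𝒞-scheme⇒≤2^ {n = 0}           _   _ = z≤n
𝒞-scheme⇒≤2^ {n = 1} {L}       _   _ = m^n>0 2 L
𝒞-scheme⇒≤2^ {n = suc (suc n)} 2≤k   = scheme⇒≤2^ (2 , completeGraph-cliqueWidth n , 2≤k)

-- Assembly of the two bounds.

theorem1 : (∃ λ (C : ℚᵘ) → 0ℚᵘ ℚᵘ.< C ×
    (∀ (k n : ℕ) → 1 ≤ k → 1 ≤ n →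
    ∃ λ (L : ℕ) → LabelingScheme (𝒞 k n) L ×
    AtMostLogs (C ℚᵘ.* fromℕ k) k n L))
    ×
    (∀ (K : ℕ) → 1 ≤ K →
    ∃ λ (c : ℚᵘ) → 0ℚᵘ ℚᵘ.< c ×
    (∀ (k n : ℕ) → 1 ≤ k → k ≤ K → 1 ≤ n →
    ∀ (L : ℕ) → LabelingScheme (𝒞 k n) L →
    AtLeastLogs (c ℚᵘ.* fromℕ k) k n L))
theorem1 = (mkℚᵘ (ℤ.+ 8) 0 , ℚᵘ.*<* (ℤ.+<+ (s≤s z≤n)) , upper) , lower
  where
  upper : ∀ k n → 1 ≤ k → 1 ≤ n →
          ∃ λ L → LabelingScheme (𝒞 k n) L × AtMostLogs (mkℚᵘ (ℤ.+ 8) 0 ℚᵘ.* fromℕ k) k n L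
  upper 1 n _ 1≤n = 0 , edgelessScheme n , atMostLogs-0 8 0 1 ≤-refl 1≤n
  upper k@(suc (suc _)) n _ 1≤n with g , n≤2^g , 2^g≤n² ← power-between n 1≤n =
    2 * g * suc k
    , searchScheme (decode k (2 * g))
        (λ G (w , (con , _) , w≤k) → constructible⇒labels (2 * g) G w≤k (enough-levels g n≤2^g) con)
    , atMostLogs g (s≤s (s≤s z≤n)) 1≤n 2^g≤n²

  lower : ∀ K → 1 ≤ K → ∃ λ c → 0ℚᵘ ℚᵘ.< c ×
          (∀ k n → 1 ≤ k → k ≤ K → 1 ≤ n → ∀ L → LabelingScheme (𝒞 k n) L →
           AtLeastLogs (c ℚᵘ.* fromℕ k) k n L)
  lower (suc K) _ = mkℚᵘ (ℤ.+ 1) (K + K * suc K) , ℚᵘ.*<* (ℤ.+<+ (s≤s z≤n)) ,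
    λ k n 1≤k k≤K _ L scheme → atLeastLogs 1≤k k≤K (λ 2≤k → 𝒞-scheme⇒≤2^ 2≤k scheme)
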